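{- Let $k > 2$ be an integer. There exists a function $\varepsilon_k:\mathbb{Z}_{>0}\to\mathbb{R}$ with $\varepsilon_k(n) = O(1/n)$ as $n\to\infty$ (the implied constant independent of $r$) such that for all positive integers $n$ and $r$, \[ \mathsf{s}_{kn}(C_n^r) > \frac{kn}{4}\left[1 + \frac{1}{ek} - \varepsilon_k(n)\right]^r . \]
   Context: $C_n = \mathbb{Z}/n\mathbb{Z}$ denotes the cyclic group of order $n$, and $C_n^r$ its $r$-fold direct product; $e$ is Euler's number. For a finite abelian group $G$ with exponent $\exp(G)=n$ (the largest order of an element of $G$) and a positive integer $k$, the generalized Erdős–Ginzburg–Ziv constant $\mathsf{s}_{kn}(G)$ is the smallest integer $m$ such that every sequence (elements may repeat) of $m$ elements of $G$ contains a subsequence of length $kn$ whose terms sum to zero in $G$. Note $\exp(C_n^r)=n$. -}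

module Defs where

open import Data.Nat as ℕ using (ℕ; zero; suc; _≤_)
open import Data.Nat.Divisibility using (_∣_)
open import Data.Integer using (+_)
open import Data.Rational as ℚ using (ℚ; _/_)
open import Data.Fin using (Fin; toℕ)
import Data.Fin as Fin
open import Data.Fin.Subset using (Subset; ∣_∣)
open import Data.Vec using ([]; _∷_)
open import Data.Bool using (true; false)
open import Data.Product using (Σ; _×_; ∃)
open import Function using (_∘_)

-- The group C_n^r and sequences in it.
-- An element of C_n^r = (ℤ/nℤ)^r is a function Fin r → Fin n
-- (coordinates taken as residues 0..n-1).  A sequence of length m is
-- a function Fin m → (Fin r → Fin n).  A subsequence is given by a
-- subset S of the index set Fin m; its length is ∣ S ∣.

subsetSum : ∀ {m} → Subset m → (Fin m → ℕ) → ℕ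
subsetSum [] f = 0
subsetSum (true ∷ S) f = f Fin.zero ℕ.+ subsetSum S (f ∘ Fin.suc)
subsetSum (false ∷ S) f = subsetSum S (f ∘ Fin.suc)

HasZeroSumSubseq : (n r L : ℕ) {m : ℕ} → (Fin m → Fin r → Fin n) → Set
HasZeroSumSubseq n r L {m} x =
  Σ (Subset m) λ S → (∣ S ∣ ≡' L) × (∀ j → n ∣ subsetSum S (λ i → toℕ (x i j)))
  where open import Relation.Binary.PropositionalEquality renaming (_≡_ to _≡'_)

EGZProperty : (n r L m : ℕ) → Set
EGZProperty n r L m = (x : Fin m → Fin r → Fin n) → HasZeroSumSubseq n r L x

IsEGZConstant : (n r L s : ℕ) → Set
IsEGZConstant n r L s = EGZProperty n r L s × (∀ m → EGZProperty n r L m → s ≤ m)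

eTerm : ℕ → ℚ
eTerm zero = ℚ.1ℚ
eTerm (suc i) = eTerm i ℚ.* (+ 1 / suc i)

eSum : ℕ → ℚ
eSum zero = eTerm zero
eSum (suc m) = eSum m ℚ.+ eTerm (suc m)

-- "t · e ≤ u"   (faithful for u > 0, the only use: eSum m increases to e)
MulE≤ : ℚ → ℚ → Set
MulE≤ t u = ∀ m → t ℚ.* eSum m ℚ.≤ u

-- "t · e ≥ u"   (faithful for u > 0)
MulE≥ : ℚ → ℚ → Set
MulE≥ t u = ∀ b → b ℚ.< u → ∃ λ m → b ℚ.< t ℚ.* eSum m

_^ℚ_ : ℚ → ℕ → ℚ
q ^ℚ zero = ℚ.1ℚ
q ^ℚ suc r = q ℚ.* (q ^ℚ r)

{-# OPTIONS --safe #-}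

-- Choose the coordinates of the sequence to be 0 or 1 with odds 1 : t, where
-- t ≈ 1/(ek).  In one coordinate, kn given terms have sum divisible by n with
-- probability (1 + t)^(−kn) Σⱼ (kn choose jn) t^(jn); since
-- (kn choose jn) t^(jn) ≤ (n/e)^(jn) / (jn)! ≤ 1 for j ≥ 1, this is at most
-- (k + 1)(1 + t)^(−kn), and k + 1 ≤ (1 + 1/n)^(kn).  So with
-- v = (1 + t)(1 − 1/n) a kn-subset survives r coordinates with probability at
-- most v^(−knr), and the union bound gives v^(knr) ≤ (s choose kn) ≤ (3s/(kn))^(kn).
-- The random choice is derandomised one coordinate at a time by averaging.
-- The number e is replaced throughout by the rational upper bound
-- eSum n + 1/n!, which is within 1/n of e.
module Submission where

open import Defs
open import Data.Bool using (Bool; true; false; if_then_else_)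
open import Data.Empty using (⊥-elim)
open import Data.Fin using (Fin; zero; suc; toℕ)
open import Data.Fin.Subset using (Subset; ∣_∣; _∩_)
open import Data.Integer using (+_)
import Data.Integer as ℤ
import Data.Integer.Properties as ℤ
open import Data.List using (List; []; _∷_; _++_; map; filter; length)
open import Data.List.Membership.Propositional using (_∈_)
open import Data.List.Membership.Propositional.Properties using (∈-filter⁺; ∈-map⁺; ∈-++⁺ˡ; ∈-++⁺ʳ)
open import Data.List.Properties using (length-map; length-++)
open import Data.List.Relation.Unary.All as All using (All; []; _∷_)
import Data.List.Relation.Unary.All.Properties as All
open import Data.List.Relation.Unary.Any using (here)
open import Data.Nat as ℕ using (ℕ; zero; suc; z≤n; s≤s)
open import Data.Nat.Divisibility using (_∣_; _∣?_; divides)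
import Data.Nat.Properties as ℕ
open import Data.Product using (Σ; ∃; _×_; _,_)
open import Data.Rational using (ℚ; 0ℚ; 1ℚ; _/_; _+_; _*_; _-_; -_; _≤_; _<_; 1/_; fromℚᵘ; positive; nonNegative; NonZero; >-nonZero)
open import Data.Rational.Properties
import Data.Rational.Unnormalised as ℚᵘ
import Data.Rational.Unnormalised.Properties as ℚᵘ
open import Data.Sum using (inj₁; inj₂)
open import Data.Vec using ([]; _∷_; lookup)
import Data.Vec.Functional as Vector
open import Level using (0ℓ)
open import Relation.Binary.PropositionalEquality
open import Relation.Nullary using (Dec; yes; no; does)
open import Relation.Nullary.Decidable.Core using (dec⇒maybe)
open import Relation.Unary using (Decidable)
open import Tactic.RingSolver using (solve-∀)
open import Tactic.RingSolver.Core.AlmostCommutativeRing using (AlmostCommutativeRing; fromCommutativeRing)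

-- Rational arithmetic: embedded naturals, order, powers, Bernoulli's inequality.

ring : AlmostCommutativeRing 0ℓ 0ℓ
ring = fromCommutativeRing +-*-commutativeRing (λ x → dec⇒maybe (0ℚ ≟ x))

ι : ℕ → ℚ
ι n = + n / 1

-- Normalisation blocks computation on fractions with variable numerators, so identities are checked
-- on unnormalised rationals and carried over by these homomorphism laws.
fromℚᵘ-homo-+ : ∀ p q → fromℚᵘ (p ℚᵘ.+ q) ≡ fromℚᵘ p + fromℚᵘ q
fromℚᵘ-homo-+ p q = toℚᵘ-injective (ℚᵘ.≃-trans (toℚᵘ-fromℚᵘ (p ℚᵘ.+ q))
  (ℚᵘ.≃-sym (ℚᵘ.≃-trans (toℚᵘ-homo-+ (fromℚᵘ p) (fromℚᵘ q))
    (ℚᵘ.+-cong (toℚᵘ-fromℚᵘ p) (toℚᵘ-fromℚᵘ q)))))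

fromℚᵘ-homo-* : ∀ p q → fromℚᵘ (p ℚᵘ.* q) ≡ fromℚᵘ p * fromℚᵘ q
fromℚᵘ-homo-* p q = toℚᵘ-injective (ℚᵘ.≃-trans (toℚᵘ-fromℚᵘ (p ℚᵘ.* q))
  (ℚᵘ.≃-sym (ℚᵘ.≃-trans (toℚᵘ-homo-* (fromℚᵘ p) (fromℚᵘ q))
    (ℚᵘ.*-cong (toℚᵘ-fromℚᵘ p) (toℚᵘ-fromℚᵘ q)))))

ι-* : ∀ m n → ι (m ℕ.* n) ≡ ι m * ι n
ι-* m n = trans (fromℚᵘ-cong {ℚᵘ.mkℚᵘ (+ (m ℕ.* n)) 0} {ℚᵘ.mkℚᵘ (+ m) 0 ℚᵘ.* ℚᵘ.mkℚᵘ (+ n) 0}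
    (ℚᵘ.*≡* (cong (ℤ._* + 1) (ℤ.pos-* m n))))
  (fromℚᵘ-homo-* (ℚᵘ.mkℚᵘ (+ m) 0) (ℚᵘ.mkℚᵘ (+ n) 0))

ι-suc : ∀ n → ι (suc n) ≡ 1ℚ + ι n
ι-suc n = trans (fromℚᵘ-cong {ℚᵘ.mkℚᵘ (+ suc n) 0} {ℚᵘ.1ℚᵘ ℚᵘ.+ ℚᵘ.mkℚᵘ (+ n) 0}
    (ℚᵘ.*≡* (cong (λ z → (+ 1 ℤ.+ z) ℤ.* + 1) (sym (ℤ.*-identityʳ (+ n))))))
  (fromℚᵘ-homo-+ ℚᵘ.1ℚᵘ (ℚᵘ.mkℚᵘ (+ n) 0))

/-*-cancel : ∀ m d → (+ m / suc d) * ι (suc d) ≡ ι m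
/-*-cancel m d = trans (sym (fromℚᵘ-homo-* (ℚᵘ.mkℚᵘ (+ m) d) (ℚᵘ.mkℚᵘ (+ suc d) 0)))
  (fromℚᵘ-cong {ℚᵘ.mkℚᵘ (+ m) d ℚᵘ.* ℚᵘ.mkℚᵘ (+ suc d) 0} {ℚᵘ.mkℚᵘ (+ m) 0}
    (ℚᵘ.*≡* (ℤ.*-assoc (+ m) (+ suc d) (+ 1))))

ι-suc′ : ∀ n → ι (suc n) ≡ ι n + 1ℚ
ι-suc′ n = trans (ι-suc n) (+-comm 1ℚ (ι n))

0≤1 : 0ℚ ≤ 1ℚ
0≤1 = nonNegative⁻¹ 1ℚ

0≤+ : ∀ {p q} → 0ℚ ≤ p → 0ℚ ≤ q → 0ℚ ≤ p + q
0≤+ = +-mono-≤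

0≤ι : ∀ n → 0ℚ ≤ ι n
0≤ι zero = ≤-refl
0≤ι (suc n) = subst (0ℚ ≤_) (sym (ι-suc n)) (0≤+ 0≤1 (0≤ι n))

0<ι : ∀ n → 0ℚ < ι (suc n)
0<ι n = subst (0ℚ <_) (sym (ι-suc n)) (+-mono-<-≤ (positive⁻¹ 1ℚ) (0≤ι n))

ι-mono : ∀ {m n} → m ℕ.≤ n → ι m ≤ ι n
ι-mono {n = n} z≤n = 0≤ι n
ι-mono (s≤s {m} {n} m≤n) = subst₂ _≤_ (sym (ι-suc m)) (sym (ι-suc n)) (+-monoʳ-≤ 1ℚ (ι-mono m≤n))

*-monoˡ : ∀ {p q r} → 0ℚ ≤ r → p ≤ q → r * p ≤ r * q
*-monoˡ {r = r} 0≤r = *-monoˡ-≤-nonNeg r {{nonNegative 0≤r}}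

*-monoʳ : ∀ {p q r} → 0ℚ ≤ r → p ≤ q → p * r ≤ q * r
*-monoʳ {r = r} 0≤r = *-monoʳ-≤-nonNeg r {{nonNegative 0≤r}}

*-mono : ∀ {p q r s} → 0ℚ ≤ q → 0ℚ ≤ r → p ≤ q → r ≤ s → p * r ≤ q * s
*-mono 0≤q 0≤r p≤q r≤s = ≤-trans (*-monoʳ 0≤r p≤q) (*-monoˡ 0≤q r≤s)

0≤* : ∀ {p q} → 0ℚ ≤ p → 0ℚ ≤ q → 0ℚ ≤ p * q
0≤* {p} {q} 0≤p 0≤q = subst (_≤ p * q) (*-zeroʳ p) (*-monoˡ 0≤p 0≤q)

0<* : ∀ {p q} → 0ℚ < p → 0ℚ < q → 0ℚ < p * q
0<* {p} {q} 0<p 0<q = positive⁻¹ (p * q) {{pos*pos⇒pos p {{positive 0<p}} q {{positive 0<q}}}}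

*-cancelˡ : ∀ {p q r} → 0ℚ < r → r * p ≤ r * q → p ≤ q
*-cancelˡ {r = r} 0<r = *-cancelˡ-≤-pos r {{positive 0<r}}

*-cancelʳ : ∀ {p q r} → 0ℚ < r → p * r ≤ q * r → p ≤ q
*-cancelʳ {r = r} 0<r = *-cancelʳ-≤-pos r {{positive 0<r}}

0≤^ : ∀ {q} → 0ℚ ≤ q → ∀ n → 0ℚ ≤ q ^ℚ n
0≤^ 0≤q zero = 0≤1
0≤^ 0≤q (suc n) = 0≤* 0≤q (0≤^ 0≤q n)

0<^ : ∀ {q} → 0ℚ < q → ∀ n → 0ℚ < q ^ℚ n
0<^ 0<q zero = positive⁻¹ 1ℚ
0<^ 0<q (suc n) = 0<* 0<q (0<^ 0<q n)

^-mono : ∀ {p q} → 0ℚ ≤ p → p ≤ q → ∀ n → p ^ℚ n ≤ q ^ℚ n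
^-mono 0≤p p≤q zero = ≤-refl
^-mono 0≤p p≤q (suc n) = *-mono (≤-trans 0≤p p≤q) (0≤^ 0≤p n) p≤q (^-mono 0≤p p≤q n)

1^ : ∀ n → 1ℚ ^ℚ n ≡ 1ℚ
1^ zero = refl
1^ (suc n) = trans (*-identityˡ _) (1^ n)

*-interchange : ∀ a b c d → (a * b) * (c * d) ≡ (a * c) * (b * d)
*-interchange = solve-∀ ring

^-distrib-* : ∀ p q n → (p * q) ^ℚ n ≡ p ^ℚ n * q ^ℚ n
^-distrib-* p q zero = refl
^-distrib-* p q (suc n) = trans (cong (p * q *_) (^-distrib-* p q n)) (*-interchange p q (p ^ℚ n) (q ^ℚ n))

^-comm : ∀ q m n → (q ^ℚ m) ^ℚ n ≡ (q ^ℚ n) ^ℚ m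
^-comm q m zero = sym (1^ m)
^-comm q m (suc n) = trans (cong (q ^ℚ m *_) (^-comm q m n)) (sym (^-distrib-* q (q ^ℚ n) m))

^-mono-< : ∀ {p q} → 0ℚ ≤ p → p < q → ∀ n → p ^ℚ suc n < q ^ℚ suc n
^-mono-< {p} {q} 0≤p p<q n = ≤-<-trans (*-monoˡ 0≤p (^-mono 0≤p (<⇒≤ p<q) n))
  (*-monoˡ-<-pos (q ^ℚ n) {{positive (0<^ (≤-<-trans 0≤p p<q) n)}} p<q)

^-cancel-≤ : ∀ {p q} → 0ℚ ≤ q → ∀ n → p ^ℚ suc n ≤ q ^ℚ suc n → p ≤ q
^-cancel-≤ 0≤q n h = ≮⇒≥ λ q<p → <-irrefl refl (<-≤-trans (^-mono-< 0≤q q<p n) h)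

bernoulli : ∀ {x t} → 0ℚ ≤ x → 0ℚ ≤ t → ∀ n → x ^ℚ suc n + ι (suc n) * t * x ^ℚ n ≤ (x + t) ^ℚ suc n
bernoulli {x} {t} 0≤x 0≤t zero = ≤-reflexive (eq x t)
  where
  eq : ∀ x t → x * 1ℚ + 1ℚ * t * 1ℚ ≡ (x + t) * 1ℚ
  eq = solve-∀ ring
bernoulli {x} {t} 0≤x 0≤t (suc n) = begin
  x * (x * x ^ℚ n) + ι (suc (suc n)) * t * (x * x ^ℚ n)
    ≡⟨ cong (λ z → x * (x * x ^ℚ n) + z * t * (x * x ^ℚ n)) (ι-suc (suc n)) ⟩
  x * (x * x ^ℚ n) + (1ℚ + c) * t * (x * x ^ℚ n)
    ≡⟨ +-identityʳ _ ⟨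
  x * (x * x ^ℚ n) + (1ℚ + c) * t * (x * x ^ℚ n) + 0ℚ
    -- The added nonnegative term c t² xⁿ makes the whole expression divisible by x + t.
    ≤⟨ +-monoʳ-≤ (x * (x * x ^ℚ n) + (1ℚ + c) * t * (x * x ^ℚ n)) (0≤* (0≤* (0≤* 0≤t (0≤ι (suc n))) 0≤t) (0≤^ 0≤x n)) ⟩
  x * (x * x ^ℚ n) + (1ℚ + c) * t * (x * x ^ℚ n) + t * c * t * x ^ℚ n
    ≡⟨ regroup x t c (x ^ℚ n) ⟩
  (x + t) * (x * x ^ℚ n + c * t * x ^ℚ n)
    ≤⟨ *-monoˡ (0≤+ 0≤x 0≤t) (bernoulli 0≤x 0≤t n) ⟩
  (x + t) * (x + t) ^ℚ suc n ∎
  where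
  open ≤-Reasoning
  c = ι (suc n)
  regroup : ∀ x t c a → x * (x * a) + (1ℚ + c) * t * (x * a) + t * c * t * a
    ≡ (x + t) * (x * a + c * t * a)
  regroup = solve-∀ ring

-- Finite sums and binomially weighted sums.

Σ≤ : ℕ → (ℕ → ℚ) → ℚ
Σ≤ zero f = f 0
Σ≤ (suc m) f = Σ≤ m f + f (suc m)

Σ≤-mono : ∀ m {f g} → (∀ i → i ℕ.≤ m → f i ≤ g i) → Σ≤ m f ≤ Σ≤ m g
Σ≤-mono zero f≤g = f≤g 0 z≤n
Σ≤-mono (suc m) f≤g = +-mono-≤ (Σ≤-mono m λ i i≤m → f≤g i (ℕ.m≤n⇒m≤1+n i≤m)) (f≤g (suc m) ℕ.≤-refl)

0≤Σ≤ : ∀ m {f} → (∀ i → 0ℚ ≤ f i) → 0ℚ ≤ Σ≤ m f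
0≤Σ≤ zero 0≤f = 0≤f 0
0≤Σ≤ (suc m) 0≤f = 0≤+ (0≤Σ≤ m 0≤f) (0≤f (suc m))

p≤p+q : ∀ {p q} → 0ℚ ≤ q → p ≤ p + q
p≤p+q {p} {q} 0≤q = subst (_≤ p + q) (+-identityʳ p) (+-monoʳ-≤ p 0≤q)

p≤q+p : ∀ {p q} → 0ℚ ≤ q → p ≤ q + p
p≤q+p {p} {q} 0≤q = subst (p ≤_) (+-comm p q) (p≤p+q 0≤q)

term≤Σ≤ : ∀ m {f} → (∀ i → 0ℚ ≤ f i) → ∀ {j} → j ℕ.≤ m → f j ≤ Σ≤ m f
term≤Σ≤ zero 0≤f z≤n = ≤-refl
term≤Σ≤ (suc m) {f} 0≤f {j} j≤1+m with ℕ.m≤n⇒m<n∨m≡n j≤1+m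
... | inj₁ (s≤s j≤m) = ≤-trans (term≤Σ≤ m 0≤f j≤m) (p≤p+q (0≤f (suc m)))
... | inj₂ refl = p≤q+p (0≤Σ≤ m 0≤f)

Σ≤-const : ∀ m → Σ≤ m (λ _ → 1ℚ) ≡ ι (suc m)
Σ≤-const zero = refl
Σ≤-const (suc m) = trans (cong (_+ 1ℚ) (Σ≤-const m)) (sym (ι-suc′ (suc m)))

eSum≡Σ≤ : ∀ m → eSum m ≡ Σ≤ m eTerm
eSum≡Σ≤ zero = refl
eSum≡Σ≤ (suc m) = cong (_+ eTerm (suc m)) (eSum≡Σ≤ m)

-- binSum t L h = Σᵢ (L choose i) tⁱ h i.
binSum : ℚ → ℕ → (ℕ → ℚ) → ℚ
binSum t zero h = h 0
binSum t (suc L) h = binSum t L h + t * binSum t L (λ i → h (suc i))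

binSum-mono : ∀ {t} → 0ℚ ≤ t → ∀ L {g h} → (∀ i → i ℕ.≤ L → g i ≤ h i) → binSum t L g ≤ binSum t L h
binSum-mono 0≤t zero g≤h = g≤h 0 z≤n
binSum-mono 0≤t (suc L) g≤h = +-mono-≤ (binSum-mono 0≤t L λ i i≤L → g≤h i (ℕ.m≤n⇒m≤1+n i≤L))
  (*-monoˡ 0≤t (binSum-mono 0≤t L λ i i≤L → g≤h (suc i) (s≤s i≤L)))

binSum-+ : ∀ t L g h → binSum t L (λ i → g i + h i) ≡ binSum t L g + binSum t L h
binSum-+ t zero g h = refl
binSum-+ t (suc L) g h = trans
  (cong₂ (λ a b → a + t * b) (binSum-+ t L g h) (binSum-+ t L (λ i → g (suc i)) (λ i → h (suc i))))
  (eq (binSum t L g) (binSum t L h) t (binSum t L (λ i → g (suc i))) (binSum t L (λ i → h (suc i))))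
  where
  eq : ∀ a b t c d → (a + b) + t * (c + d) ≡ (a + t * c) + (b + t * d)
  eq = solve-∀ ring

binSum-Σ≤ : ∀ t L m (g : ℕ → ℕ → ℚ) → binSum t L (λ i → Σ≤ m (λ j → g j i)) ≡ Σ≤ m (λ j → binSum t L (g j))
binSum-Σ≤ t L zero g = refl
binSum-Σ≤ t L (suc m) g = trans (binSum-+ t L (λ i → Σ≤ m (λ j → g j i)) (g (suc m)))
  (cong (_+ binSum t L (g (suc m))) (binSum-Σ≤ t L m g))

binSum-0 : ∀ t L → binSum t L (λ _ → 0ℚ) ≡ 0ℚ
binSum-0 t zero = refl
binSum-0 t (suc L) = trans (cong (λ z → z + t * z) (binSum-0 t L)) (trans (+-identityˡ (t * 0ℚ)) (*-zeroʳ t))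

binSum-1 : ∀ t L → binSum t L (λ _ → 1ℚ) ≡ (1ℚ + t) ^ℚ L
binSum-1 t zero = refl
binSum-1 t (suc L) = trans (eq t (binSum t L (λ _ → 1ℚ))) (cong ((1ℚ + t) *_) (binSum-1 t L))
  where
  eq : ∀ t a → a + t * a ≡ (1ℚ + t) * a
  eq = solve-∀ ring

𝟙 : Bool → ℚ
𝟙 b = if b then 1ℚ else 0ℚ

0≤𝟙 : ∀ b → 0ℚ ≤ 𝟙 b
0≤𝟙 true = 0≤1
0≤𝟙 false = ≤-refl

-- The Boolean test makes `kron (suc i) (suc j)` reduce to `kron i j` and `kron 0 (suc j)` to 0, so
-- `binSum t L (kron i)` obeys Pascal's rule by computation.
kron : ℕ → ℕ → ℚ
kron i j = 𝟙 (i ℕ.≡ᵇ j)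

kron-refl : ∀ i → kron i i ≡ 1ℚ
kron-refl zero = refl
kron-refl (suc i) = kron-refl i

eTerm-suc : ∀ i → eTerm (suc i) * ι (suc i) ≡ eTerm i
eTerm-suc i = trans (*-assoc (eTerm i) _ _) (trans (cong (eTerm i *_) (/-*-cancel 1 i)) (*-identityʳ (eTerm i)))

0<1/ : ∀ i → 0ℚ < + 1 / suc i
0<1/ i = positive⁻¹ (+ 1 / suc i) {{normalize-pos 1 (suc i)}}

0<eTerm : ∀ i → 0ℚ < eTerm i
0<eTerm zero = positive⁻¹ 1ℚ
0<eTerm (suc i) = 0<* (0<eTerm i) (0<1/ i)

0≤eTerm : ∀ i → 0ℚ ≤ eTerm i
0≤eTerm i = <⇒≤ (0<eTerm i)

-- Binomial coefficients satisfy (L choose i) ≤ Lⁱ/i!.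
binSum-kron≤ : ∀ {t} → 0ℚ ≤ t → ∀ L i → binSum t L (kron i) ≤ eTerm i * (ι L * t) ^ℚ i
binSum-kron≤ 0≤t zero zero = ≤-refl
binSum-kron≤ {t} 0≤t zero (suc i) = 0≤* (0≤eTerm (suc i)) (0≤^ (0≤* (0≤ι 0) 0≤t) (suc i))
binSum-kron≤ {t} 0≤t (suc L) zero = begin
  binSum t L (kron 0) + t * binSum t L (λ _ → 0ℚ)
    ≡⟨ cong (λ z → binSum t L (kron 0) + t * z) (binSum-0 t L) ⟩
  binSum t L (kron 0) + t * 0ℚ
    ≡⟨ trans (cong (_+_ (binSum t L (kron 0))) (*-zeroʳ t)) (+-identityʳ _) ⟩
  binSum t L (kron 0)
    ≤⟨ binSum-kron≤ 0≤t L zero ⟩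
  1ℚ * 1ℚ ∎
  where open ≤-Reasoning
binSum-kron≤ {t} 0≤t (suc L) (suc i) = begin
  binSum t L (kron (suc i)) + t * binSum t L (kron i)
    ≤⟨ +-mono-≤ (binSum-kron≤ 0≤t L (suc i)) (*-monoˡ 0≤t (binSum-kron≤ 0≤t L i)) ⟩
  eTerm (suc i) * y ^ℚ suc i + t * (eTerm i * y ^ℚ i)
    ≡⟨ cong (λ z → eTerm (suc i) * y ^ℚ suc i + t * (z * y ^ℚ i)) (eTerm-suc i) ⟨
  eTerm (suc i) * y ^ℚ suc i + t * (eTerm (suc i) * ι (suc i) * y ^ℚ i)
    ≡⟨ eq (eTerm (suc i)) (y ^ℚ suc i) t (ι (suc i)) (y ^ℚ i) ⟩
  eTerm (suc i) * (y ^ℚ suc i + ι (suc i) * t * y ^ℚ i)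
    -- With y = Lt, the bracket holds the first two terms of the expansion of (y + t)^(i+1).
    ≤⟨ *-monoˡ (0≤eTerm (suc i)) (bernoulli (0≤* (0≤ι L) 0≤t) 0≤t i) ⟩
  eTerm (suc i) * (y + t) ^ℚ suc i
    ≡⟨ cong (λ z → eTerm (suc i) * z ^ℚ suc i) (trans (eq′ (ι L) t) (cong (_* t) (sym (ι-suc L)))) ⟩
  eTerm (suc i) * (ι (suc L) * t) ^ℚ suc i ∎
  where
  open ≤-Reasoning
  y = ι L * t
  eq : ∀ e a t c b → e * a + t * (e * c * b) ≡ e * (a + c * t * b)
  eq = solve-∀ ring
  eq′ : ∀ l t → l * t + t ≡ (1ℚ + l) * t
  eq′ = solve-∀ ring

-- Rational upper bounds for e and a Stirling-type estimate.

-- Expresses e ≤ E without real numbers, e being the supremum of the partial sums.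
UpperBoundE : ℚ → Set
UpperBoundE E = ∀ m → eSum m ≤ E

-- In the binomial expansion the j-th term (m choose j)/mʲ is at most 1/j!, so the total is at most
-- `eSum m`. The indicators `kron j` isolate the single terms.
[1+1/m]^m≤E : ∀ {E} → UpperBoundE E → ∀ m {x} → 0ℚ ≤ x → ι m * x ≡ 1ℚ → (1ℚ + x) ^ℚ m ≤ E
[1+1/m]^m≤E {E} e≤E m {x} 0≤x mx≡1 = begin
  (1ℚ + x) ^ℚ m                            ≡⟨ binSum-1 x m ⟨
  binSum x m (λ _ → 1ℚ)                         ≤⟨ binSum-mono 0≤x m (λ i i≤m →
    subst (_≤ Σ≤ m (λ j → kron j i)) (kron-refl i)
      (term≤Σ≤ m {λ j → kron j i} (λ j → 0≤𝟙 (j ℕ.≡ᵇ i)) i≤m)) ⟩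
  binSum x m (λ i → Σ≤ m (λ j → kron j i))      ≡⟨ binSum-Σ≤ x m m kron ⟩
  Σ≤ m (λ j → binSum x m (kron j))              ≤⟨ Σ≤-mono m (λ j _ → subst (binSum x m (kron j) ≤_) (term j) (binSum-kron≤ 0≤x m j)) ⟩
  Σ≤ m eTerm                               ≡⟨ eSum≡Σ≤ m ⟨
  eSum m                                   ≤⟨ e≤E m ⟩
  E ∎
  where
  open ≤-Reasoning
  term : ∀ j → eTerm j * (ι m * x) ^ℚ j ≡ eTerm j
  term j = trans (cong (λ z → eTerm j * z ^ℚ j) mx≡1)
    (trans (cong (eTerm j *_) (1^ j)) (*-identityʳ (eTerm j)))

-- Induction on mᵐ/m!: passing from m to m + 1 multiplies it by (1 + 1/m)ᵐ ≤ E. The case m = 1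
-- stands apart because that ratio needs m ≥ 1.
stirling : ∀ {E} → UpperBoundE E → ∀ m → eTerm m * ι m ^ℚ m ≤ E ^ℚ m
stirling e≤E zero = ≤-refl
stirling {E} e≤E (suc zero) = ≤-trans (e≤E 0) (≤-reflexive (sym (*-identityʳ E)))
stirling {E} e≤E (suc m@(suc m′)) = begin
  eTerm (suc m) * (ι (suc m) * ι (suc m) ^ℚ m)
    ≡⟨ *-assoc (eTerm (suc m)) (ι (suc m)) (ι (suc m) ^ℚ m) ⟨
  eTerm (suc m) * ι (suc m) * ι (suc m) ^ℚ m
    ≡⟨ cong₂ (λ a b → a * b ^ℚ m) (eTerm-suc m) factor ⟩
  eTerm m * ((1ℚ + x) * ι m) ^ℚ m
    ≡⟨ cong (eTerm m *_) (^-distrib-* (1ℚ + x) (ι m) m) ⟩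
  eTerm m * ((1ℚ + x) ^ℚ m * ι m ^ℚ m)
    ≡⟨ eq (eTerm m) ((1ℚ + x) ^ℚ m) (ι m ^ℚ m) ⟩
  (1ℚ + x) ^ℚ m * (eTerm m * ι m ^ℚ m)
    ≤⟨ *-mono (≤-trans 0≤1 (e≤E 0)) (0≤* (0≤eTerm m) (0≤^ (0≤ι m) m))
         ([1+1/m]^m≤E e≤E m (<⇒≤ (0<1/ m′)) mx≡1) (stirling e≤E m) ⟩
  E * E ^ℚ m ∎
  where
  open ≤-Reasoning
  x = + 1 / m
  mx≡1 : ι m * x ≡ 1ℚ
  mx≡1 = trans (*-comm (ι m) x) (/-*-cancel 1 m′)
  factor : ι (suc m) ≡ (1ℚ + x) * ι m
  factor = trans (ι-suc m) (sym (trans (*-distribʳ-+ (ι m) 1ℚ x)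
    (trans (cong₂ _+_ (*-identityˡ (ι m)) (/-*-cancel 1 m′)) (+-comm (ι m) 1ℚ))))
  eq : ∀ a b c → a * (b * c) ≡ b * (a * c)
  eq = solve-∀ ring

E⁺ : ℕ → ℚ
E⁺ n = eSum n + eTerm n

1≤ιsuc : ∀ n → 1ℚ ≤ ι (suc n)
1≤ιsuc n = ι-mono (s≤s (z≤n {n}))

eTerm≤1 : ∀ n → eTerm n ≤ 1ℚ
eTerm≤1 zero = ≤-refl
eTerm≤1 (suc n) = begin
  eTerm (suc n)              ≡⟨ *-identityʳ _ ⟨
  eTerm (suc n) * 1ℚ         ≤⟨ *-monoˡ (0≤eTerm (suc n)) (1≤ιsuc n) ⟩
  eTerm (suc n) * ι (suc n)  ≡⟨ eTerm-suc n ⟩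
  eTerm n                    ≤⟨ eTerm≤1 n ⟩
  1ℚ ∎
  where open ≤-Reasoning

eSum-mono : ∀ d m → eSum m ≤ eSum (d ℕ.+ m)
eSum-mono zero m = ≤-refl
eSum-mono (suc d) m = ≤-trans (eSum-mono d m) (p≤p+q (0≤eTerm (suc (d ℕ.+ m))))

1≤eSum : ∀ m → 1ℚ ≤ eSum m
1≤eSum m = subst (λ z → 1ℚ ≤ eSum z) (ℕ.+-identityʳ m) (eSum-mono m 0)

-- The new term counts twice, and 2/(n+2)! ≤ 1/(n+1)!.
E⁺-step : ∀ n → E⁺ (suc (suc n)) ≤ E⁺ (suc n)
E⁺-step n = begin
  eSum (suc n) + e + e              ≡⟨ +-assoc (eSum (suc n)) e e ⟩
  eSum (suc n) + (e + e)            ≤⟨ +-monoʳ-≤ (eSum (suc n)) e+e≤ ⟩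
  eSum (suc n) + eTerm (suc n)      ∎
  where
  open ≤-Reasoning
  e = eTerm (suc (suc n))
  double : ∀ e → e + e ≡ e * (1ℚ + 1ℚ)
  double = solve-∀ ring
  e+e≤ : e + e ≤ eTerm (suc n)
  e+e≤ = subst₂ _≤_ (sym (double e)) (eTerm-suc (suc n))
    (*-monoˡ (0≤eTerm (suc (suc n))) (ι-mono {2} {suc (suc n)} (s≤s (s≤s z≤n))))

E⁺-antitone : ∀ d n → E⁺ (suc (d ℕ.+ n)) ≤ E⁺ (suc n)
E⁺-antitone zero n = ≤-refl
E⁺-antitone (suc d) n = ≤-trans (E⁺-step (d ℕ.+ n)) (E⁺-antitone d n)

-- Partial sums increase while `E⁺` decreases from index 1 on, and `eSum m ≤ E⁺ m`. Index 0 is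
-- excluded, since `E⁺ 0` is 2, below e.
e≤E⁺ : ∀ n → UpperBoundE (E⁺ (suc n))
e≤E⁺ n m with ℕ.≤-total m (suc n)
... | inj₁ m≤n = ≤-trans
  (subst (λ z → eSum m ≤ eSum z) (ℕ.m∸n+n≡m m≤n) (eSum-mono (suc n ℕ.∸ m) m))
  (p≤p+q (0≤eTerm (suc n)))
e≤E⁺ n zero | inj₂ ()
e≤E⁺ n (suc m) | inj₂ (s≤s n≤m) = ≤-trans (p≤p+q (0≤eTerm (suc m)))
  (subst (λ z → E⁺ (suc z) ≤ E⁺ (suc n)) (ℕ.m∸n+n≡m n≤m) (E⁺-antitone (m ℕ.∸ n) n))

-- Zero sums in one coordinate.

𝟙-does≤ : ∀ {P : Set} (P? : Dec P) {q} → 0ℚ ≤ q → (P → 1ℚ ≤ q) → 𝟙 (does P?) ≤ q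
𝟙-does≤ (yes p) 0≤q 1≤q = 1≤q p
𝟙-does≤ (no _) 0≤q 1≤q = 0≤q

-- Only the indices 0, n, ..., kn contribute, and each of these k + 1 terms is at most 1. The choice
-- t = 1/(Ek) gives LtE = n, which is what lets `stirling` bound a term.
multiples-bound : ∀ {E t} → UpperBoundE E → 0ℚ ≤ t → ∀ k p → t * (E * ι k) ≡ 1ℚ →
  binSum t (k ℕ.* suc p) (λ i → 𝟙 (does (suc p ∣? i))) ≤ ι (suc k)
multiples-bound {E} {t} e≤E 0≤t k p tEk≡1 = begin
  binSum t L (λ i → 𝟙 (does (n ∣? i)))
    ≤⟨ binSum-mono 0≤t L pointwise ⟩
  binSum t L (λ i → Σ≤ k (λ j → kron (j ℕ.* n) i))
    ≡⟨ binSum-Σ≤ t L k (λ j → kron (j ℕ.* n)) ⟩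
  Σ≤ k (λ j → binSum t L (kron (j ℕ.* n)))
    ≤⟨ Σ≤-mono k (λ j _ → ≤-trans (binSum-kron≤ 0≤t L (j ℕ.* n)) (term≤1 j)) ⟩
  Σ≤ k (λ _ → 1ℚ)
    ≡⟨ Σ≤-const k ⟩
  ι (suc k) ∎
  where
  open ≤-Reasoning
  n = suc p
  L = k ℕ.* n

  pointwise : ∀ i → i ℕ.≤ L → 𝟙 (does (n ∣? i)) ≤ Σ≤ k (λ j → kron (j ℕ.* n) i)
  pointwise i i≤L = 𝟙-does≤ (n ∣? i) (0≤Σ≤ k (λ j → 0≤𝟙 (j ℕ.* n ℕ.≡ᵇ i))) λ { (divides j refl) →
    subst (_≤ Σ≤ k (λ j′ → kron (j′ ℕ.* n) (j ℕ.* n))) (kron-refl (j ℕ.* n))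
      (term≤Σ≤ k {λ j′ → kron (j′ ℕ.* n) (j ℕ.* n)} (λ j′ → 0≤𝟙 (j′ ℕ.* n ℕ.≡ᵇ j ℕ.* n)) (ℕ.*-cancelʳ-≤ j k n i≤L)) }

  0<E : 0ℚ < E
  0<E = <-≤-trans (positive⁻¹ 1ℚ) (e≤E 0)

  LtE≡n : ι L * t * E ≡ ι n
  LtE≡n = trans (cong (λ z → z * t * E) (ι-* k n)) (trans (eq (ι k) (ι n) t E)
    (trans (cong (ι n *_) tEk≡1) (*-identityʳ (ι n))))
    where
    eq : ∀ k n t E → k * n * t * E ≡ n * (t * (E * k))
    eq = solve-∀ ring

  term≤1 : ∀ j → eTerm (j ℕ.* n) * (ι L * t) ^ℚ (j ℕ.* n) ≤ 1ℚ
  term≤1 zero = ≤-refl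
  term≤1 (suc j) = *-cancelʳ (0<^ 0<E i) (begin
    eTerm i * (ι L * t) ^ℚ i * E ^ℚ i    ≡⟨ *-assoc (eTerm i) _ _ ⟩
    eTerm i * ((ι L * t) ^ℚ i * E ^ℚ i)  ≡⟨ cong (eTerm i *_) (^-distrib-* (ι L * t) E i) ⟨
    eTerm i * (ι L * t * E) ^ℚ i         ≡⟨ cong (λ z → eTerm i * z ^ℚ i) LtE≡n ⟩
    -- Here i is a positive multiple of n, so n ≤ i brings the power into the form of `stirling`.
    eTerm i * ι n ^ℚ i                   ≤⟨ *-monoˡ (0≤eTerm i) (^-mono (0≤ι n) (ι-mono (ℕ.m≤m+n n (j ℕ.* n))) i) ⟩
    eTerm i * ι i ^ℚ i                   ≤⟨ stirling e≤E i ⟩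
    E ^ℚ i                               ≡⟨ *-identityˡ _ ⟨
    1ℚ * E ^ℚ i ∎)
    where i = suc j ℕ.* n

-- Weighted averages over 0/1 columns.

-- wSum t s f = Σₓ t^∣x∣ f x.
wSum : ℚ → ∀ s → (Subset s → ℚ) → ℚ
wSum t zero f = f []
wSum t (suc s) f = wSum t s (λ x → f (false ∷ x)) + t * wSum t s (λ x → f (true ∷ x))

wSum-cong : ∀ t s {f g} → (∀ x → f x ≡ g x) → wSum t s f ≡ wSum t s g
wSum-cong t zero f≡g = f≡g []
wSum-cong t (suc s) f≡g = cong₂ (λ a b → a + t * b)
  (wSum-cong t s (λ x → f≡g (false ∷ x))) (wSum-cong t s (λ x → f≡g (true ∷ x)))

wSum-+ : ∀ t s f g → wSum t s (λ x → f x + g x) ≡ wSum t s f + wSum t s g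
wSum-+ t zero f g = refl
wSum-+ t (suc s) f g = trans
  (cong₂ (λ a b → a + t * b) (wSum-+ t s (λ x → f (false ∷ x)) (λ x → g (false ∷ x)))
                             (wSum-+ t s (λ x → f (true ∷ x)) (λ x → g (true ∷ x))))
  (eq (wSum t s (λ x → f (false ∷ x))) (wSum t s (λ x → g (false ∷ x))) t
    (wSum t s (λ x → f (true ∷ x))) (wSum t s (λ x → g (true ∷ x))))
  where
  eq : ∀ a b t c d → (a + b) + t * (c + d) ≡ (a + t * c) + (b + t * d)
  eq = solve-∀ ring

wSum-0 : ∀ t s → wSum t s (λ _ → 0ℚ) ≡ 0ℚ
wSum-0 t zero = refl
wSum-0 t (suc s) = trans (cong (λ z → z + t * z) (wSum-0 t s)) (trans (+-identityˡ (t * 0ℚ)) (*-zeroʳ t))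

-- Each position outside S contributes a factor 1 + t whatever its bit. After normalisation, ∣S ∩ x∣
-- is binomial with ∣S∣ trials at odds 1 : t; the powers of 1 + t are cross-multiplied to avoid
-- division.
wSum-∩ : ∀ t {s} (S : Subset s) h →
  (1ℚ + t) ^ℚ ∣ S ∣ * wSum t s (λ x → h ∣ S ∩ x ∣) ≡ (1ℚ + t) ^ℚ s * binSum t ∣ S ∣ h
wSum-∩ t [] h = refl
wSum-∩ t {suc s} (false ∷ S) h = trans (eq t ((1ℚ + t) ^ℚ ∣ S ∣) _)
  (trans (cong ((1ℚ + t) *_) (wSum-∩ t S h)) (sym (*-assoc (1ℚ + t) _ _)))
  where
  eq : ∀ t p a → p * (a + t * a) ≡ (1ℚ + t) * (p * a)
  eq = solve-∀ ring
wSum-∩ t {suc s} (true ∷ S) h = trans (eq t ((1ℚ + t) ^ℚ ∣ S ∣) _ _)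
  (trans (cong₂ (λ a b → (1ℚ + t) * (a + t * b)) (wSum-∩ t S h) (wSum-∩ t S (λ i → h (suc i))))
    (eq′ t ((1ℚ + t) ^ℚ s) _ _))
  where
  eq : ∀ t p a b → (1ℚ + t) * p * (a + t * b) ≡ (1ℚ + t) * (p * a + t * (p * b))
  eq = solve-∀ ring
  eq′ : ∀ t p a b → (1ℚ + t) * (p * a + t * (p * b)) ≡ (1ℚ + t) * p * (a + t * b)
  eq′ = solve-∀ ring

-- The total weight of all x is (1 + t)^s, so the hypothesis says that w f has mean at most c. A
-- suitable x is found by conditional expectations, fixing one bit at a time to a half whose mean is
-- still at most c.
wSum-average : ∀ {t} → 0ℚ ≤ t → ∀ s {w c} (f : Subset s → ℚ) →
  w * wSum t s f ≤ c * (1ℚ + t) ^ℚ s → ∃ λ x → w * f x ≤ c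
wSum-average 0≤t zero {c = c} f h = [] , subst (_ ≤_) (*-identityʳ c) h
wSum-average {t} 0≤t (suc s) {w} {c} f h
  with w * wSum t s (λ x → f (false ∷ x)) ≤? c * (1ℚ + t) ^ℚ s
... | yes A≤ = let x , fx≤ = wSum-average 0≤t s {w} (λ x → f (false ∷ x)) A≤ in false ∷ x , fx≤
... | no A≰ with w * wSum t s (λ x → f (true ∷ x)) ≤? c * (1ℚ + t) ^ℚ s
...   | yes B≤ = let x , fx≤ = wSum-average 0≤t s {w} (λ x → f (true ∷ x)) B≤ in true ∷ x , fx≤
...   | no B≰ = ⊥-elim (<-irrefl refl (begin-strict
  c * ((1ℚ + t) * P)         ≡⟨ eq c t P ⟩
  -- Strictness comes from the `false` half, of weight 1; the weight t of the other half may be 0.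
  c * P + t * (c * P)        <⟨ +-mono-<-≤ (≰⇒> A≰) (*-monoˡ 0≤t (<⇒≤ (≰⇒> B≰))) ⟩
  w * A + t * (w * B)        ≡⟨ eq′ w A t B ⟩
  w * (A + t * B)            ≤⟨ h ⟩
  c * ((1ℚ + t) * P) ∎))
  where
  open ≤-Reasoning
  A = wSum t s (λ x → f (false ∷ x))
  B = wSum t s (λ x → f (true ∷ x))
  P = (1ℚ + t) ^ℚ s
  eq : ∀ c t p → c * ((1ℚ + t) * p) ≡ c * p + t * (c * p)
  eq = solve-∀ ring
  eq′ : ∀ w a t b → w * a + t * (w * b) ≡ w * (a + t * b)
  eq′ = solve-∀ ring

-- Derandomised choice of the columns.

ι-+ : ∀ m n → ι (m ℕ.+ n) ≡ ι m + ι n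
ι-+ zero n = sym (+-identityˡ (ι n))
ι-+ (suc m) n = trans (ι-suc (m ℕ.+ n)) (trans (cong (_+_ 1ℚ) (ι-+ m n))
  (trans (sym (+-assoc 1ℚ (ι m) (ι n))) (cong (_+ ι n) (sym (ι-suc m)))))

length-filter-∷ : ∀ {A : Set} {P : A → Set} (P? : Decidable P) x xs →
  ι (length (filter P? (x ∷ xs))) ≡ 𝟙 (does (P? x)) + ι (length (filter P? xs))
length-filter-∷ P? x xs with does (P? x)
... | true = ι-suc (length (filter P? xs))
... | false = sym (+-identityˡ _)

module _ (n : ℕ) {s : ℕ} where

  -- The index sets in the list over which the 0/1 column x sums to zero modulo n.
  survivors : Subset s → List (Subset s) → List (Subset s)
  survivors x = filter (λ S → n ∣? ∣ S ∩ x ∣)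

  hit : ℕ → ℚ
  hit i = 𝟙 (does (n ∣? i))

  -- `binSum t L hit` over (1 + t)^L is the probability that a given L-set survives a random column;
  -- `w-bound` caps it by 1/w in division-free form.
  module _ {t w : ℚ} (0≤t : 0ℚ ≤ t) (L : ℕ) (w-bound : w * binSum t L hit ≤ (1ℚ + t) ^ℚ L) where

    wSum-hit : ∀ S → ∣ S ∣ ≡ L → w * wSum t s (λ x → hit ∣ S ∩ x ∣) ≤ (1ℚ + t) ^ℚ s
    wSum-hit S refl = *-cancelˡ (0<^ 0<1+t ∣ S ∣) (begin
      (1ℚ + t) ^ℚ ∣ S ∣ * (w * A)         ≡⟨ eq ((1ℚ + t) ^ℚ ∣ S ∣) w A ⟩
      w * ((1ℚ + t) ^ℚ ∣ S ∣ * A)         ≡⟨ cong (w *_) (wSum-∩ t S hit) ⟩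
      w * ((1ℚ + t) ^ℚ s * binSum t L hit)  ≡⟨ eq w ((1ℚ + t) ^ℚ s) _ ⟩
      (1ℚ + t) ^ℚ s * (w * binSum t L hit)  ≤⟨ *-monoˡ (<⇒≤ (0<^ 0<1+t s)) w-bound ⟩
      (1ℚ + t) ^ℚ s * (1ℚ + t) ^ℚ L       ≡⟨ *-comm ((1ℚ + t) ^ℚ s) ((1ℚ + t) ^ℚ L) ⟩
      (1ℚ + t) ^ℚ ∣ S ∣ * (1ℚ + t) ^ℚ s ∎)
      where
      open ≤-Reasoning
      A = wSum t s (λ x → hit ∣ S ∩ x ∣)
      0<1+t : 0ℚ < 1ℚ + t
      0<1+t = +-mono-<-≤ (positive⁻¹ 1ℚ) 0≤t
      eq : ∀ a b c → a * (b * c) ≡ b * (a * c)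
      eq = solve-∀ ring

    -- Linearity of expectation, adding `wSum-hit` over the members of F.
    wSum-survivors : ∀ F → All (λ S → ∣ S ∣ ≡ L) F →
      w * wSum t s (λ x → ι (length (survivors x F))) ≤ ι (length F) * (1ℚ + t) ^ℚ s
    wSum-survivors [] [] = ≤-reflexive (trans (cong (w *_) (wSum-0 t s))
      (trans (*-zeroʳ w) (sym (*-zeroˡ ((1ℚ + t) ^ℚ s)))))
    wSum-survivors (S ∷ F) (∣S∣≡L ∷ ∣F∣≡L) = begin
      w * wSum t s (λ x → ι (length (survivors x (S ∷ F))))
        ≡⟨ cong (w *_) (trans (wSum-cong t s (λ x → length-filter-∷ (λ S → n ∣? ∣ S ∩ x ∣) S F))
             (wSum-+ t s (λ x → hit ∣ S ∩ x ∣) (λ x → ι (length (survivors x F))))) ⟩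
      w * (wSum t s (λ x → hit ∣ S ∩ x ∣) + wSum t s (λ x → ι (length (survivors x F))))
        ≡⟨ *-distribˡ-+ w _ _ ⟩
      w * wSum t s (λ x → hit ∣ S ∩ x ∣) + w * wSum t s (λ x → ι (length (survivors x F)))
        ≤⟨ +-mono-≤ (wSum-hit S ∣S∣≡L) (wSum-survivors F ∣F∣≡L) ⟩
      (1ℚ + t) ^ℚ s + ι (length F) * (1ℚ + t) ^ℚ s
        ≡⟨ eq ((1ℚ + t) ^ℚ s) (ι (length F)) ⟩
      (1ℚ + ι (length F)) * (1ℚ + t) ^ℚ s
        ≡⟨ cong (_* (1ℚ + t) ^ℚ s) (ι-suc (length F)) ⟨
      ι (suc (length F)) * (1ℚ + t) ^ℚ s ∎
      where
      open ≤-Reasoning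
      eq : ∀ a b → a + b * a ≡ (1ℚ + b) * a
      eq = solve-∀ ring

    -- Averaging gives a first column x with w times the number of survivors at most the size of F;
    -- the other columns are then chosen against these survivors alone.
    columns : 0ℚ ≤ w → ∀ r F → All (λ S → ∣ S ∣ ≡ L) F →
      ∃ λ (X : Fin r → Subset s) → ∃ λ F′ →
        (∀ {S} → S ∈ F → (∀ j → n ∣ ∣ S ∩ X j ∣) → S ∈ F′) ×
        w ^ℚ r * ι (length F′) ≤ ι (length F)
    columns 0≤w zero F _ = (λ ()) , F , (λ S∈F _ → S∈F) , ≤-reflexive (*-identityˡ _)
    columns 0≤w (suc r) F ∣F∣≡L =
      let x , wF₁≤F = wSum-average 0≤t s {w} (λ x → ι (length (survivors x F))) (wSum-survivors F ∣F∣≡L)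
          X , F′ , F₁⊆F′ , wF′≤F₁ = columns 0≤w r (survivors x F) (All.filter⁺ (λ S → n ∣? ∣ S ∩ x ∣) ∣F∣≡L)
      in x Vector.∷ X , F′
        , (λ S∈F hits → F₁⊆F′ (∈-filter⁺ (λ S → n ∣? ∣ S ∩ x ∣) S∈F (hits zero)) (λ j → hits (suc j)))
        , ≤-trans (≤-reflexive (*-assoc w (w ^ℚ r) _)) (≤-trans (*-monoˡ 0≤w wF′≤F₁) wF₁≤F)

-- Listing and counting index sets of a given size.

subsets : ∀ s → ℕ → List (Subset s)
subsets zero zero = [] ∷ []
subsets zero (suc L) = []
subsets (suc s) zero = map (false ∷_) (subsets s zero)
subsets (suc s) (suc L) = map (false ∷_) (subsets s (suc L)) ++ map (true ∷_) (subsets s L)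

subsets-size : ∀ s L → All (λ S → ∣ S ∣ ≡ L) (subsets s L)
subsets-size zero zero = refl ∷ []
subsets-size zero (suc L) = []
subsets-size (suc s) zero = All.map⁺ (subsets-size s zero)
subsets-size (suc s) (suc L) = All.++⁺ (All.map⁺ (subsets-size s (suc L)))
  (All.map⁺ (All.map (cong suc) (subsets-size s L)))

subsets-complete : ∀ {s} (S : Subset s) → S ∈ subsets s ∣ S ∣
subsets-complete [] = here refl
subsets-complete (true ∷ S) = ∈-++⁺ʳ (map (false ∷_) (subsets _ (suc ∣ S ∣))) (∈-map⁺ (true ∷_) (subsets-complete S))
subsets-complete (false ∷ S) with ∣ S ∣ | subsets-complete S
... | zero | S∈ = ∈-map⁺ (false ∷_) S∈
... | suc _ | S∈ = ∈-++⁺ˡ (∈-map⁺ (false ∷_) S∈)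

-- Both sides are the binomial coefficient (s choose L), computed by Pascal's rule.
length-subsets : ∀ s L → ι (length (subsets s L)) ≡ binSum 1ℚ s (kron L)
length-subsets zero zero = refl
length-subsets zero (suc L) = refl
length-subsets (suc s) zero = trans (cong ι (length-map (false ∷_) (subsets s zero)))
  (trans (length-subsets s zero) (sym (trans (cong (λ z → binSum 1ℚ s (kron 0) + 1ℚ * z) (binSum-0 1ℚ s))
    (+-identityʳ _))))
length-subsets (suc s) (suc L) = begin
  ι (length (map (false ∷_) (subsets s (suc L)) ++ map (true ∷_) (subsets s L)))
    ≡⟨ cong ι (trans (length-++ (map (false ∷_) (subsets s (suc L))))
         (cong₂ ℕ._+_ (length-map (false ∷_) (subsets s (suc L))) (length-map (true ∷_) (subsets s L)))) ⟩
  ι (length (subsets s (suc L)) ℕ.+ length (subsets s L))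
    ≡⟨ ι-+ (length (subsets s (suc L))) (length (subsets s L)) ⟩
  ι (length (subsets s (suc L))) + ι (length (subsets s L))
    ≡⟨ cong₂ _+_ (length-subsets s (suc L)) (trans (length-subsets s L) (sym (*-identityˡ _))) ⟩
  binSum 1ℚ s (kron (suc L)) + 1ℚ * binSum 1ℚ s (kron L) ∎
  where open ≡-Reasoning

length-subsets≤ : ∀ s L → ι (length (subsets s L)) ≤ eTerm L * ι s ^ℚ L
length-subsets≤ s L = subst₂ _≤_ (sym (length-subsets s L)) (cong (λ z → eTerm L * z ^ℚ L) (*-identityʳ (ι s)))
  (binSum-kron≤ 0≤1 s L)

-- From the zero-sum property to a lower bound on s.

subsetSum-indicator : ∀ {s} (S X : Subset s) (f : Fin s → ℕ) →
  (∀ i → f i ≡ (if lookup X i then 1 else 0)) → subsetSum S f ≡ ∣ S ∩ X ∣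
subsetSum-indicator [] [] f f≡X = refl
subsetSum-indicator (false ∷ S) (b ∷ X) f f≡X = subsetSum-indicator S X _ (λ i → f≡X (suc i))
subsetSum-indicator (true ∷ S) (true ∷ X) f f≡X = cong₂ ℕ._+_ (f≡X zero) (subsetSum-indicator S X _ (λ i → f≡X (suc i)))
subsetSum-indicator (true ∷ S) (false ∷ X) f f≡X = cong₂ ℕ._+_ (f≡X zero) (subsetSum-indicator S X _ (λ i → f≡X (suc i)))

-- The empty sequence has no subsequence of positive length.
EGZ⇒0< : ∀ {n r L s} → EGZProperty n r (suc L) s → 0ℚ < ι s
EGZ⇒0< {s = zero} egz with egz (λ ())
... | [] , () , _
EGZ⇒0< {s = suc s} egz = 0<ι s

1≤length : ∀ {A : Set} {x : A} {xs : List A} → x ∈ xs → 1ℚ ≤ ι (length xs)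
1≤length {xs = _ ∷ xs} _ = 1≤ιsuc (length xs)

-- The property is applied to the sequence whose j-th coordinates form the column `X j`. The
-- zero-sum subsequence it returns survives every column, so F′ is nonempty and w^r ≤ (s choose L).
-- Taking n ≥ 2 makes 1 a residue different from 0.
EGZ⇒≤length : ∀ {q L t w} → let n = suc (suc q) in
  0ℚ ≤ t → 0ℚ ≤ w → w * binSum t L (λ i → 𝟙 (does (n ∣? i))) ≤ (1ℚ + t) ^ℚ L →
  ∀ r s → EGZProperty n r L s → w ^ℚ r ≤ eTerm L * ι s ^ℚ L
EGZ⇒≤length {q} {L} {t} {w} 0≤t 0≤w w-bound r s egz
  with columns (suc (suc q)) 0≤t L w-bound 0≤w r (subsets s L) (subsets-size s L)
... | X , F′ , complete , w^rF′≤F with egz (λ i j → if lookup (X j) i then suc zero else zero)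
... | S , refl , n∣S = ≤-trans (begin
  w ^ℚ r                     ≡⟨ *-identityʳ _ ⟨
  w ^ℚ r * 1ℚ                ≤⟨ *-monoˡ (0≤^ 0≤w r) (1≤length (complete (subsets-complete S) hits)) ⟩
  w ^ℚ r * ι (length F′)     ≤⟨ w^rF′≤F ⟩
  ι (length (subsets s ∣ S ∣)) ∎) (length-subsets≤ s ∣ S ∣)
  where
  open ≤-Reasoning
  toℕ-if : ∀ b → toℕ {suc (suc q)} (if b then suc zero else zero) ≡ (if b then 1 else 0)
  toℕ-if true = refl
  toℕ-if false = refl
  hits : ∀ j → suc (suc q) ∣ ∣ S ∩ X j ∣
  hits j = subst (suc (suc q) ∣_) (subsetSum-indicator S (X j) _ (λ i → toℕ-if (lookup (X j) i))) (n∣S j)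

-- `E⁺ 1` evaluates to 3.
3^-bound : ∀ L → eTerm L * ι L ^ℚ L ≤ ι 3 ^ℚ L
3^-bound L = stirling (e≤E⁺ 0) L

-- With w = v^L, the preceding bound gives (L v^r)^L ≤ (L^L / L!) s^L ≤ (3s)^L, and L-th roots are
-- compared, L being positive.
EGZ⇒bound : ∀ {q L t v} → let n = suc (suc q) in
  0ℚ ≤ t → 0ℚ ≤ v → v ^ℚ suc L * binSum t (suc L) (λ i → 𝟙 (does (n ∣? i))) ≤ (1ℚ + t) ^ℚ suc L →
  ∀ r s → EGZProperty n r (suc L) s → ι (suc L) * v ^ℚ r ≤ ι 3 * ι s
EGZ⇒bound {q} {L′} {t} {v} 0≤t 0≤v v-bound r s egz = ^-cancel-≤ (0≤* (0≤ι 3) (0≤ι s)) L′ (begin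
  (ι L * v ^ℚ r) ^ℚ L                      ≡⟨ ^-distrib-* (ι L) (v ^ℚ r) L ⟩
  ι L ^ℚ L * (v ^ℚ r) ^ℚ L                 ≡⟨ cong (ι L ^ℚ L *_) (^-comm v r L) ⟩
  ι L ^ℚ L * (v ^ℚ L) ^ℚ r                 ≤⟨ *-monoˡ (0≤^ (0≤ι L) L)
    (EGZ⇒≤length 0≤t (0≤^ 0≤v L) v-bound r s egz) ⟩
  ι L ^ℚ L * (eTerm L * ι s ^ℚ L)          ≡⟨ eq (ι L ^ℚ L) (eTerm L) (ι s ^ℚ L) ⟩
  eTerm L * ι L ^ℚ L * ι s ^ℚ L            ≤⟨ *-monoʳ (0≤^ (0≤ι s) L) (3^-bound L) ⟩
  ι 3 ^ℚ L * ι s ^ℚ L                      ≡⟨ ^-distrib-* (ι 3) (ι s) L ⟨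
  (ι 3 * ι s) ^ℚ L ∎)
  where
  open ≤-Reasoning
  L = suc L′
  eq : ∀ a b c → a * (b * c) ≡ b * a * c
  eq = solve-∀ ring

-- Choice of the parameters and distance from 1/(ek).

module Witness (k′ p : ℕ) where
  k = suc k′
  n = suc p
  L = k ℕ.* n
  E = E⁺ n
  y = + 1 / n

  0≤y : 0ℚ ≤ y
  0≤y = <⇒≤ (0<1/ p)

  yn≡1 : y * ι n ≡ 1ℚ
  yn≡1 = /-*-cancel 1 p

  y≤1 : y ≤ 1ℚ
  y≤1 = subst₂ _≤_ (*-identityʳ y) yn≡1 (*-monoˡ 0≤y (1≤ιsuc p))

  1≤E : 1ℚ ≤ E
  1≤E = e≤E⁺ p 0

  1≤Ek : 1ℚ ≤ E * ι k
  1≤Ek = *-mono (≤-trans 0≤1 1≤E) 0≤1 1≤E (1≤ιsuc k′)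

  instance
    Ek-nonZero : NonZero (E * ι k)
    Ek-nonZero = >-nonZero (<-≤-trans (positive⁻¹ 1ℚ) 1≤Ek)

  t : ℚ
  t = 1/ (E * ι k)

  tEk≡1 : t * (E * ι k) ≡ 1ℚ
  tEk≡1 = *-inverseˡ (E * ι k)

  0≤t : 0ℚ ≤ t
  0≤t = *-cancelʳ (<-≤-trans (positive⁻¹ 1ℚ) 1≤Ek)
    (subst₂ _≤_ (sym (*-zeroˡ (E * ι k))) (sym tEk≡1) 0≤1)

  t≤1 : t ≤ 1ℚ
  t≤1 = subst₂ _≤_ (*-identityʳ t) tEk≡1 (*-monoˡ 0≤t 1≤Ek)

  -- The rational δ stands for 1/(ek) - ε: t approximates 1/(ek), and the correction (1 + t)/n is
  -- the price of the factor 1 - 1/n in v.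
  v δ : ℚ
  v = (1ℚ + t) * (1ℚ - y)
  δ = t - (1ℚ + t) * y

  1+δ≡v : 1ℚ + δ ≡ v
  1+δ≡v = eq t y
    where
    eq : ∀ t y → 1ℚ + (t - (1ℚ + t) * y) ≡ (1ℚ + t) * (1ℚ - y)
    eq = solve-∀ ring

  0≤1-y : 0ℚ ≤ 1ℚ - y
  0≤1-y = subst (_≤ 1ℚ - y) (+-inverseʳ y) (+-monoˡ-≤ (- y) y≤1)

  0≤1+t : 0ℚ ≤ 1ℚ + t
  0≤1+t = 0≤+ 0≤1 0≤t

  0≤v : 0ℚ ≤ v
  0≤v = 0≤* 0≤1+t 0≤1-y

  -- Bernoulli's inequality with base 1, since Ly = k.
  1+k≤[1+y]^L : ι (suc k) ≤ (1ℚ + y) ^ℚ L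
  1+k≤[1+y]^L = begin
    ι (suc k)                                          ≡⟨ ι-suc k ⟩
    1ℚ + ι k                                           ≡⟨ cong (_+_ 1ℚ) k≡Ly ⟩
    1ℚ + ι L * y                                       ≡⟨ cong (_+_ 1ℚ) (*-identityʳ (ι L * y)) ⟨
    1ℚ + ι L * y * 1ℚ                                  ≡⟨ cong₂ (λ a b → a + ι L * y * b) (1^ L) (1^ (ℕ.pred L)) ⟨
    1ℚ ^ℚ L + ι L * y * 1ℚ ^ℚ ℕ.pred L                 ≤⟨ bernoulli 0≤1 0≤y (ℕ.pred L) ⟩
    (1ℚ + y) ^ℚ L ∎
    where
    open ≤-Reasoning
    eq : ∀ k n y → k * (y * n) ≡ k * n * y
    eq = solve-∀ ring
    k≡Ly : ι k ≡ ι L * y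
    k≡Ly = trans (sym (*-identityʳ (ι k))) (trans (cong (ι k *_) (sym yn≡1))
      (trans (eq (ι k) (ι n) y) (cong (_* y) (sym (ι-* k n)))))

  -- The factor (1 - y)^L inside v^L absorbs the k + 1 of `multiples-bound`, because k + 1 ≤ (1 +
  -- y)^L and (1 - y)(1 + y) ≤ 1.
  v-bound : v ^ℚ L * binSum t L (λ i → 𝟙 (does (n ∣? i))) ≤ (1ℚ + t) ^ℚ L
  v-bound = begin
    v ^ℚ L * binSum t L (λ i → 𝟙 (does (n ∣? i)))
      ≤⟨ *-monoˡ (0≤^ 0≤v L) (multiples-bound (e≤E⁺ p) 0≤t k p tEk≡1) ⟩
    v ^ℚ L * ι (suc k)
      ≤⟨ *-monoˡ (0≤^ 0≤v L) 1+k≤[1+y]^L ⟩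
    v ^ℚ L * (1ℚ + y) ^ℚ L
      ≡⟨ ^-distrib-* v (1ℚ + y) L ⟨
    (v * (1ℚ + y)) ^ℚ L
      ≤⟨ ^-mono (0≤* 0≤v (0≤+ 0≤1 0≤y)) v[1+y]≤1+t L ⟩
    (1ℚ + t) ^ℚ L ∎
    where
    open ≤-Reasoning
    eq : ∀ t y → (1ℚ + t) * (1ℚ - y) * (1ℚ + y) + (1ℚ + t) * (y * y) ≡ 1ℚ + t
    eq = solve-∀ ring
    v[1+y]≤1+t : v * (1ℚ + y) ≤ 1ℚ + t
    v[1+y]≤1+t = subst (v * (1ℚ + y) ≤_) (eq t y) (p≤p+q (0≤* 0≤1+t (0≤* 0≤y 0≤y)))

  nδ≡nt-[1+t] : ι n * δ ≡ ι n * t - (1ℚ + t)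
  nδ≡nt-[1+t] = trans (eq (ι n) t y) (cong (_-_ (ι n * t)) (trans (cong ((1ℚ + t) *_) yn≡1) (*-identityʳ (1ℚ + t))))
    where
    eq : ∀ n t y → n * (t - (1ℚ + t) * y) ≡ n * t - (1ℚ + t) * (y * n)
    eq = solve-∀ ring

  nδ-3≤nt : ι n * δ - ι 3 ≤ ι n * t
  nδ-3≤nt = subst₂ _≤_ (cong (_- ι 3) (sym nδ≡nt-[1+t])) (eq (ι n * t) t (ι 3))
    (p≤p+q (0≤+ 0≤1+t (0≤ι 3)))
    where
    eq : ∀ a t c → a - (1ℚ + t) - c + ((1ℚ + t) + c) ≡ a
    eq = solve-∀ ring

  -- Source of the constant 3: n t exceeds n δ by 1 + t ≤ 2, and one more unit is spent in `lower`
  -- on the gap between E and `eSum n`.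
  nt+1≤nδ+3 : ι n * t + 1ℚ ≤ ι n * δ + ι 3
  nt+1≤nδ+3 = begin
    ι n * t + 1ℚ                          ≡⟨ eq (ι n * t) t ⟩
    ι n * t - (1ℚ + t) + (1ℚ + (1ℚ + t))  ≤⟨ +-monoʳ-≤ (ι n * t - (1ℚ + t)) (+-monoʳ-≤ 1ℚ (+-monoʳ-≤ 1ℚ t≤1)) ⟩
    ι n * t - (1ℚ + t) + ι 3              ≡⟨ cong (_+ ι 3) nδ≡nt-[1+t] ⟨
    ι n * δ + ι 3 ∎
    where
    open ≤-Reasoning
    eq : ∀ a t → a + 1ℚ ≡ a - (1ℚ + t) + (1ℚ + (1ℚ + t))
    eq = solve-∀ ring

  -- Each partial sum is at most E, and k n t E = n.
  upper : MulE≤ (ι k * (ι n * δ - ι 3)) (ι n)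
  upper m = begin
    ι k * (ι n * δ - ι 3) * eSum m   ≤⟨ *-monoʳ (≤-trans 0≤1 (1≤eSum m)) (*-monoˡ (0≤ι k) nδ-3≤nt) ⟩
    ι k * (ι n * t) * eSum m         ≤⟨ *-monoˡ (0≤* (0≤ι k) (0≤* (0≤ι n) 0≤t)) (e≤E⁺ p m) ⟩
    ι k * (ι n * t) * E              ≡⟨ eq (ι k) (ι n) t E ⟩
    ι n * (t * (E * ι k))            ≡⟨ trans (cong (ι n *_) tEk≡1) (*-identityʳ (ι n)) ⟩
    ι n ∎
    where
    open ≤-Reasoning
    eq : ∀ k n t e → k * (n * t) * e ≡ n * (t * (e * k))
    eq = solve-∀ ring

  -- The partial sum of index n serves every b. It falls short of E by 1/n!, and n/n! = 1/(n-1)! ≤ 1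
  -- ≤ `eSum n` keeps the resulting loss within the extra unit.
  lower : MulE≥ (ι k * (ι n * δ + ι 3)) (ι n)
  lower b b<n = n , <-≤-trans b<n (begin
    ι n
      ≡⟨ trans (cong (ι n *_) tEk≡1) (*-identityʳ (ι n)) ⟨
    ι n * (t * ((eSum n + eTerm n) * ι k))
      ≡⟨ eq (ι n) t (eSum n) (eTerm n) (ι k) ⟩
    ι k * (ι n * t) * eSum n + ι k * (t * (eTerm n * ι n))
      ≤⟨ +-monoʳ-≤ (ι k * (ι n * t) * eSum n) (*-monoˡ (0≤ι k) t[eTerm*n]≤eSum) ⟩
    ι k * (ι n * t) * eSum n + ι k * eSum n
      ≡⟨ eq′ (ι k) (ι n * t) (eSum n) ⟩
    ι k * (ι n * t + 1ℚ) * eSum n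
      ≤⟨ *-monoʳ (≤-trans 0≤1 (1≤eSum n)) (*-monoˡ (0≤ι k) nt+1≤nδ+3) ⟩
    ι k * (ι n * δ + ι 3) * eSum n ∎)
    where
    open ≤-Reasoning
    eq : ∀ n t s e k → n * (t * ((s + e) * k)) ≡ k * (n * t) * s + k * (t * (e * n))
    eq = solve-∀ ring
    eq′ : ∀ k a s → k * a * s + k * s ≡ k * (a + 1ℚ) * s
    eq′ = solve-∀ ring
    t[eTerm*n]≤eSum : t * (eTerm n * ι n) ≤ eSum n
    t[eTerm*n]≤eSum = ≤-trans
      (*-mono 0≤1 (0≤* (0≤eTerm n) (0≤ι n)) t≤1 (≤-trans (≤-reflexive (eTerm-suc p)) (eTerm≤1 p)))
      (1≤eSum n)

-- The strict bound and the conclusion.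

-- For n = 1 the factor 1 - 1/n makes v zero, and r ≥ 1 leaves 0 < s. For n ≥ 2, L v^r ≤ 3s < 4s as
-- s is positive.
v^r*L/4<s : ∀ k′ p r s → let open Witness k′ p in
  1 ℕ.≤ r → EGZProperty n r L s → (+ L / 4) * v ^ℚ r < ι s
v^r*L/4<s k′ zero (suc r) s _ egz = ≤-<-trans (≤-reflexive (begin
  q * ((1ℚ + t) * 0ℚ * v ^ℚ r)  ≡⟨ cong (λ z → q * (z * v ^ℚ r)) (*-zeroʳ (1ℚ + t)) ⟩
  q * (0ℚ * v ^ℚ r)             ≡⟨ cong (q *_) (*-zeroˡ (v ^ℚ r)) ⟩
  q * 0ℚ                        ≡⟨ *-zeroʳ q ⟩
  0ℚ ∎)) (EGZ⇒0< egz)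
  where
  open Witness k′ zero
  open ≡-Reasoning
  q = + L / 4
v^r*L/4<s k′ (suc p) r s _ egz = *-cancelʳ-<-nonNeg (ι 4) (begin-strict
  (+ L / 4) * v ^ℚ r * ι 4     ≡⟨ eq (+ L / 4) (v ^ℚ r) (ι 4) ⟩
  (+ L / 4) * ι 4 * v ^ℚ r     ≡⟨ cong (_* v ^ℚ r) (/-*-cancel L 3) ⟩
  ι L * v ^ℚ r                 ≤⟨ EGZ⇒bound 0≤t 0≤v v-bound r s egz ⟩
  ι 3 * ι s                    <⟨ *-monoˡ-<-pos (ι s) {{positive (EGZ⇒0< egz)}} 3<4 ⟩
  ι 4 * ι s                    ≡⟨ *-comm (ι 4) (ι s) ⟩
  ι s * ι 4 ∎)
  where
  open Witness k′ (suc p)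
  open ≤-Reasoning
  eq : ∀ a b c → a * b * c ≡ a * c * b
  eq = solve-∀ ring
  3<4 : ι 3 < ι 4
  3<4 = +-mono-≤-< (≤-refl {ι 3}) (positive⁻¹ 1ℚ)

δ : ℕ → ℕ → ℚ
δ (suc k′) (suc p) = Witness.δ k′ p
-- Default value at k = 0 or n = 0, outside the range of the theorem.
δ _ _ = 0ℚ

theorem2 : (k : ℕ) → 2 ℕ.< k →
    Σ (ℕ → ℚ) λ δ → Σ ℚ λ C → Σ ℕ λ N →
    ((n : ℕ) → 1 ℕ.≤ n → N ℕ.≤ n →
    MulE≤ ((+ k / 1) * ((+ n / 1) * δ n - C)) (+ n / 1)
    × MulE≥ ((+ k / 1) * ((+ n / 1) * δ n + C)) (+ n / 1))
    × ((n r s : ℕ) → 1 ℕ.≤ n → 1 ℕ.≤ r → IsEGZConstant n r (k ℕ.* n) s →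
    ((+ (k ℕ.* n) / 4) * ((1ℚ + δ n) ^ℚ r)) < (+ s / 1))
-- The constant 3 works for every k: `upper` and `lower` together say that δ differs from 1/(ek) by
-- at most 3/n for all n ≥ 1.
theorem2 k@(suc k′) _ = δ k , ι 3 , 1
  , (λ { (suc p) _ _ → Witness.upper k′ p , Witness.lower k′ p })
  , λ { (suc p) r s _ 1≤r (egz , _) → subst (λ z → (+ (k ℕ.* suc p) / 4) * z ^ℚ r < ι s)
          (sym (Witness.1+δ≡v k′ p)) (v^r*L/4<s k′ p r s 1≤r egz) }
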